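{- For every integer $t\geq 4$, every graph $G$ that does not contain $K_t$ as a minor is $(2t-2)$-colourable with clustering $\lceil \tfrac{1}{2}(t-2)\rceil$.
   Context: All graphs are finite and simple. A graph $G$ is $k$-colourable with clustering $c$ if each vertex can be assigned one of $k$ colours (not necessarily properly) such that every monochromatic component (a connected component of the subgraph induced by the vertices of one colour) has at most $c$ vertices. -}

module Defs where

open import Data.Nat.Base using (ℕ; _≤_)
open import Data.Fin.Base using (Fin)
open import Data.Bool.Base using (Bool; true; false)
open import Data.Maybe.Base using (Maybe; just)
open import Data.List.Base using (List; length)
open import Data.List.Relation.Unary.All using (All)
open import Data.List.Relation.Unary.Unique.Propositional using (Unique)
open import Data.Product.Base using (∃; ∃₂; _×_)
open import Relation.Binary.PropositionalEquality using (_≡_; _≢_)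

record Graph (n : ℕ) : Set where
  field
    adj   : Fin n → Fin n → Bool
    sym   : ∀ u v → adj u v ≡ adj v u
    irrfl : ∀ v → adj v v ≡ false
open Graph public

data WalkIn {n : ℕ} (G : Graph n) (P : Fin n → Set) : Fin n → Fin n → Set where
  here : ∀ {u} → P u → WalkIn G P u u
  step : ∀ {u w v} → P u → adj G u w ≡ true → WalkIn G P w v → WalkIn G P u v

Connected : {n : ℕ} → Graph n → (Fin n → Set) → Set
Connected G S = ∀ u v → S u → S v → WalkIn G S u v

-- A K_t-minor model: pairwise disjoint branch sets B_1..B_t (encoded by a
-- partial map β : V(G) → Maybe (Fin t); branch set i = {v | β v ≡ just i}),
-- each nonempty and connected, with an edge between any two distinct ones.
record KMinorModel {n : ℕ} (t : ℕ) (G : Graph n) : Set where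
  field
    β         : Fin n → Maybe (Fin t)
    nonempty  : ∀ i → ∃ λ v → β v ≡ just i
    connected : ∀ i → Connected G (λ v → β v ≡ just i)
    adjacent  : ∀ i j → i ≢ j →
                ∃₂ λ u v → β u ≡ just i × β v ≡ just j × adj G u v ≡ true

HasKMinor : {n : ℕ} → ℕ → Graph n → Set
HasKMinor t G = KMinorModel t G

SameMonoComponent : {n k : ℕ} → Graph n → (Fin n → Fin k) → Fin n → Fin n → Set
SameMonoComponent G col v u = WalkIn G (λ w → col w ≡ col v) v u

-- col is a colouring with clustering c: every monochromatic component has at
-- most c vertices (every duplicate-free list of vertices of the component
-- of any vertex v has length ≤ c).
HasClustering : {n k : ℕ} → Graph n → (Fin n → Fin k) → ℕ → Set
HasClustering G col c =
  ∀ v (xs : List _) → Unique xs → All (SameMonoComponent G col v) xs → length xs ≤ c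

ColourableWithClustering : {n : ℕ} → Graph n → ℕ → ℕ → Set
ColourableWithClustering {n} G k c = ∃ λ (col : Fin n → Fin k) → HasClustering G col c

{-# OPTIONS --safe #-}
-- Cut off connected pieces one at a time, keeping the invariant that the pieces adjacent to any
-- component C of the uncoloured rest are pairwise adjacent.  Together with C they form a clique
-- minor, so there are at most t ∸ 2 of them.  Inside C choose a terminal next to each of them; the
-- next piece is a connected set W containing the terminals, which preserves the invariant.  W gets
-- one of t ∸ 1 main colours, different from those of the adjacent earlier pieces, and two shades
-- of it with clusters of size at most ⌈ t ∸ 2 /2⌉.
--
-- For the shades, delete non-terminal vertices as long as C stays connected.  If only terminals
-- are left, split them into halves.  Otherwise every non-terminal is a cut vertex, and among the
-- parts they cut off there is an X of terminals only, at most half of them, attached at a single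
-- vertex v.  Shade C ─ X by induction, with v replacing X as a terminal, and give X the shade
-- opposite to v.
module Submission where

open import Defs
open import Data.Nat.Base using (ℕ; zero; suc; _+_; _≤_; _<_; _*_; _∸_; ⌊_/2⌋; ⌈_/2⌉; z≤n; s≤s; s≤s⁻¹)
open import Data.Nat.Properties
  using (≤-refl; ≤-trans; <-≤-trans; ≤-reflexive; ≤-total; <⇒≱; ≰⇒>; +-suc; +-mono-≤;
         m≤n⇒m≤1+n; m≤n⇒m⊓n≡m; ⌊n/2⌋-mono; ⌊n/2⌋≤⌈n/2⌉; n≡⌊n+n/2⌋)
open import Data.Bool.Base using (true; if_then_else_)
open import Data.Bool.Properties using () renaming (_≟_ to _≟ᵇ_)
open import Data.Fin.Base using (Fin; zero; suc; opposite; combine)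
open import Data.Fin.Properties using (_≟_; any?; combine-injective; injective⇒≤)
open import Data.Fin.Subset
  using (Subset; inside; outside; _∈_; _∉_; _⊆_; _⊂_; _∩_; _∪_; _─_; _-_; ⁅_⁆; ⊤; ⊥; ∣_∣; Nonempty)
open import Data.Fin.Subset.Properties
open import Data.List.Base using (List; []; _∷_; length; map; filter; take; lookup)
import Data.List.Membership.DecPropositional as DecMembership
open import Data.List.Membership.Propositional using () renaming (_∈_ to _∈ˡ_; _∉_ to _∉ˡ_)
open import Data.List.Membership.Propositional.Properties using (∈-filter⁺; ∈-lookup; ∈-map⁺)
open import Data.List.Properties using (length-map; length-take)
open import Data.List.Relation.Unary.All as All using (All; []; _∷_)
import Data.List.Relation.Unary.All.Properties as All
open import Data.List.Relation.Unary.AllPairs as AllPairs using (AllPairs; []; _∷_)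
import Data.List.Relation.Unary.AllPairs.Properties as AllPairs
open import Data.List.Relation.Unary.Any using (index)
open import Data.List.Relation.Unary.Any.Properties using (lookup-index)
open import Data.List.Relation.Unary.Unique.Propositional using (Unique)
open import Data.Maybe.Base as Maybe using (Maybe; just; nothing)
open import Data.Product.Base using (∃; ∃₂; _×_; _,_; proj₁; proj₂)
open import Data.Sum.Base using (_⊎_; inj₁; inj₂)
open import Data.Vec.Base using ([]; _∷_; here; there)
open import Function.Base using (_∘_)
open import Relation.Binary.PropositionalEquality
  using (_≡_; _≢_; refl; trans; cong; cong₂; subst) renaming (sym to ≡-sym)
open import Relation.Nullary using (¬_; Dec; yes; no; does; ¬?; contradiction)
open import Relation.Nullary.Decidable using (toSum; _×-dec_; decidable-stable; dec-true; dec-false)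

private
  variable
    n m : ℕ
    p q r : Subset n
    x y : Fin n

-- Finite subsets: cardinalities, halving, piecewise functions.

Disjoint : Subset n → Subset n → Set
Disjoint p q = ∀ {x} → x ∈ p → x ∉ q

x∈p─q⇒x∈p : x ∈ p ─ q → x ∈ p
x∈p─q⇒x∈p {p = p} {q} = p─q⊆p p q

x∈p─q⇒x∉q : x ∈ p ─ q → x ∉ q
x∈p─q⇒x∉q {p = _ ∷ p} {q = _ ∷ q} (there x∈) (there x∈q) = x∈p─q⇒x∉q {p = p} {q} x∈ x∈q
x∈p─q⇒x∉q {p = _ ∷ p} {q = inside ∷ q} () here

x∈p-y⇒x≢y : x ∈ p - y → x ≢ y
x∈p-y⇒x≢y x∈ refl = x∈p─q⇒x∉q x∈ (x∈⁅x⁆ _)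

∣p∪q∣≤∣p∣+∣q∣ : (p q : Subset n) → ∣ p ∪ q ∣ ≤ ∣ p ∣ + ∣ q ∣
∣p∪q∣≤∣p∣+∣q∣ []            []            = z≤n
∣p∪q∣≤∣p∣+∣q∣ (outside ∷ p) (outside ∷ q) = ∣p∪q∣≤∣p∣+∣q∣ p q
∣p∪q∣≤∣p∣+∣q∣ (outside ∷ p) (inside  ∷ q) =
  subst (suc ∣ p ∪ q ∣ ≤_) (≡-sym (+-suc ∣ p ∣ ∣ q ∣)) (s≤s (∣p∪q∣≤∣p∣+∣q∣ p q))
∣p∪q∣≤∣p∣+∣q∣ (inside  ∷ p) (outside ∷ q) = s≤s (∣p∪q∣≤∣p∣+∣q∣ p q)
∣p∪q∣≤∣p∣+∣q∣ (inside  ∷ p) (inside  ∷ q) =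
  s≤s (≤-trans (∣p∪q∣≤∣p∣+∣q∣ p q) (+-mono-≤ (≤-refl {∣ p ∣}) (m≤n⇒m≤1+n ≤-refl)))

disjoint⇒∣p∣+∣q∣≤∣p∪q∣ : (p q : Subset n) → Disjoint p q → ∣ p ∣ + ∣ q ∣ ≤ ∣ p ∪ q ∣
disjoint⇒∣p∣+∣q∣≤∣p∪q∣ []            []            _ = z≤n
disjoint⇒∣p∣+∣q∣≤∣p∪q∣ (inside  ∷ p) (inside  ∷ q) d = contradiction here (d here)
disjoint⇒∣p∣+∣q∣≤∣p∪q∣ (outside ∷ p) (outside ∷ q) d =
  disjoint⇒∣p∣+∣q∣≤∣p∪q∣ p q (λ x∈p x∈q → d (there x∈p) (there x∈q))
disjoint⇒∣p∣+∣q∣≤∣p∪q∣ (inside  ∷ p) (outside ∷ q) d =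
  s≤s (disjoint⇒∣p∣+∣q∣≤∣p∪q∣ p q (λ x∈p x∈q → d (there x∈p) (there x∈q)))
disjoint⇒∣p∣+∣q∣≤∣p∪q∣ (outside ∷ p) (inside  ∷ q) d =
  subst (_≤ suc ∣ p ∪ q ∣) (≡-sym (+-suc ∣ p ∣ ∣ q ∣))
    (s≤s (disjoint⇒∣p∣+∣q∣≤∣p∪q∣ p q (λ x∈p x∈q → d (there x∈p) (there x∈q))))

disjoint⇒∣p∣+∣q∣≤∣r∣ : Disjoint p q → p ⊆ r → q ⊆ r → ∣ p ∣ + ∣ q ∣ ≤ ∣ r ∣
disjoint⇒∣p∣+∣q∣≤∣r∣ {p = p} {q} {r} d p⊆r q⊆r =
  ≤-trans (disjoint⇒∣p∣+∣q∣≤∣p∪q∣ p q d) (p⊆q⇒∣p∣≤∣q∣ p∪q⊆r)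
  where
  p∪q⊆r : p ∪ q ⊆ r
  p∪q⊆r x∈ with x∈p∪q⁻ p q x∈
  ... | inj₁ x∈p = p⊆r x∈p
  ... | inj₂ x∈q = q⊆r x∈q

nonempty⇒0<∣p∣ : Nonempty p → 0 < ∣ p ∣
nonempty⇒0<∣p∣ (x , x∈p) =
  subst (_≤ _) (∣⁅x⁆∣≡1 x) (p⊆q⇒∣p∣≤∣q∣ (λ y∈ → subst (_∈ _) (≡-sym (x∈⁅y⁆⇒x≡y x y∈)) x∈p))

⊂-<-suc : p ⊂ q → ∣ q ∣ < suc m → ∣ p ∣ < m
⊂-<-suc p⊂q ∣q∣<1+m = <-≤-trans (p⊂q⇒∣p∣<∣q∣ p⊂q) (s≤s⁻¹ ∣q∣<1+m)

unique⊆⇒length≤∣p∣ : {xs : List (Fin n)} → Unique xs → All (_∈ p) xs → length xs ≤ ∣ p ∣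
unique⊆⇒length≤∣p∣ []           []         = z≤n
unique⊆⇒length≤∣p∣ (x∉xs ∷ xs!) (x∈p ∷ xs⊆p) =
  <-≤-trans (s≤s (unique⊆⇒length≤∣p∣ xs! (All.zipWith (λ (x≢y , y∈p) → x∈p∧x≢y⇒x∈p-y y∈p (x≢y ∘ ≡-sym)) (x∉xs , xs⊆p))))
            (x∈p⇒∣p-x∣<∣p∣ x∈p)

-- ⌈ suc n /2⌉ is suc ⌊ n /2⌋, so the two halves trade places with each new element.
halve : (p : Subset n) → ∃₂ λ q r → q ⊆ p × r ⊆ p × (∀ {x} → x ∈ p → x ∉ q → x ∈ r) ×
                                    ∣ q ∣ ≤ ⌈ ∣ p ∣ /2⌉ × ∣ r ∣ ≤ ⌊ ∣ p ∣ /2⌋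
halve []            = [] , [] , (λ ()) , (λ ()) , (λ ()) , z≤n , z≤n
halve (outside ∷ p) with halve p
... | q , r , q⊆ , r⊆ , cover , ∣q∣≤ , ∣r∣≤ =
  outside ∷ q , outside ∷ r , s⊆s q⊆ , s⊆s r⊆ ,
  (λ { (there x∈p) x∉ → there (cover x∈p (x∉ ∘ there)) }) , ∣q∣≤ , ∣r∣≤
halve (inside ∷ p) with halve p
... | q , r , q⊆ , r⊆ , cover , ∣q∣≤ , ∣r∣≤ =
  inside ∷ r , outside ∷ q , s⊆s r⊆ , out⊆ q⊆ , cover′ , s≤s ∣r∣≤ , ∣q∣≤
  where
  cover′ : ∀ {x} → x ∈ inside ∷ p → x ∉ inside ∷ r → x ∈ outside ∷ q
  cover′ here        x∉ = contradiction here x∉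
  cover′ (there {i = x} x∈p) x∉ with x ∈? q
  ... | yes x∈q = there x∈q
  ... | no  x∉q = contradiction (there (cover x∈p x∉q)) x∉

override : {A : Set} → Subset n → (Fin n → A) → (Fin n → A) → Fin n → A
override p f g x = if does (x ∈? p) then f x else g x

override-∈ : {A : Set} (f g : Fin n → A) → x ∈ p → override p f g x ≡ f x
override-∈ {x = x} {p} f g x∈p rewrite dec-true (x ∈? p) x∈p = refl

override-∉ : {A : Set} (f g : Fin n → A) → x ∉ p → override p f g x ≡ g x
override-∉ {x = x} {p} f g x∉p rewrite dec-false (x ∈? p) x∉p = refl

opposite≢ : (i : Fin 2) → opposite i ≢ i
opposite≢ zero ()
opposite≢ (suc zero) ()

-- Pigeonhole: if every element of `Fin m` occurred in `xs`, the positions of occurrence would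
-- inject `Fin m` into `Fin (length xs)`.
missing : (xs : List (Fin m)) → length xs < m → ∃ (_∉ˡ xs)
missing {m} xs ∣xs∣<m with any? (λ x → ¬? (DecMembership._∈?_ _≟_ x xs))
... | yes x∉xs = x∉xs
... | no  ∄x∉xs = contradiction (injective⇒≤ index-injective) (<⇒≱ ∣xs∣<m)
  where
  all∈ : ∀ x → x ∈ˡ xs
  all∈ x = decidable-stable (DecMembership._∈?_ _≟_ x xs) (λ x∉ → ∄x∉xs (x , x∉))
  index-injective : ∀ {x y} → index (all∈ x) ≡ index (all∈ y) → x ≡ y
  index-injective {x} {y} eq =
    trans (lookup-index (all∈ x)) (trans (cong (lookup xs) eq) (≡-sym (lookup-index (all∈ y))))

allPairs-zip : {A : Set} {P : A → Set} {R S : A → A → Set} {xs : List A} →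
               (∀ {x y} → P x → P y → R x y → S x y) → All P xs → AllPairs R xs → AllPairs S xs
allPairs-zip f []         []         = []
allPairs-zip f (px ∷ pxs) (rx ∷ rxs) =
  All.zipWith (λ (py , r) → f px py r) (pxs , rx) ∷ allPairs-zip f pxs rxs

module _ {n : ℕ} (G : Graph n) where

  infix 4 _~_
  _~_ : Fin n → Fin n → Set
  u ~ v = adj G u v ≡ true

  ~-sym : ∀ {u v} → u ~ v → v ~ u
  ~-sym {u} {v} u~v = trans (Graph.sym G v u) u~v

  _~?_ : ∀ u v → Dec (u ~ v)
  u ~? v = adj G u v ≟ᵇ true

  private
    variable
      P Q : Fin n → Set
      u v w : Fin n
      C D S X : Subset n

  -- Walks, connected sets and components.

  walk-source : WalkIn G P u v → P u
  walk-source (here pu)     = pu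
  walk-source (step pu _ _) = pu

  walk-trans : WalkIn G P u v → WalkIn G P v w → WalkIn G P u w
  walk-trans (here _)          q = q
  walk-trans (step pu u~x p) q = step pu u~x (walk-trans p q)

  walk-sym : WalkIn G P u v → WalkIn G P v u
  walk-sym (here pu)       = here pu
  walk-sym (step pu u~x p) =
    walk-trans (walk-sym p) (step (walk-source p) (~-sym u~x) (here pu))

  walk-map : (∀ {x} → P x → Q x) → WalkIn G P u v → WalkIn G Q u v
  walk-map f (here pu)       = here (f pu)
  walk-map f (step pu u~x p) = step (f pu) u~x (walk-map f p)

  walk-closed : (∀ {a b} → Q a → P b → a ~ b → Q b) → Q u → WalkIn G P u v → Q v
  walk-closed cl qu (here _)       = qu
  walk-closed cl qu (step _ u~x p) = walk-closed cl (cl qu (walk-source p) u~x) p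

  Conn : Subset n → Set
  Conn C = Connected G (_∈ C)

  hub⇒connected : (∀ {u} → u ∈ C → WalkIn G (_∈ C) u w) → Conn C
  hub⇒connected to-w u v u∈C v∈C = walk-trans (to-w u∈C) (walk-sym (to-w v∈C))

  -- Maximality is recorded as closure under single edges of `C`, the form that `walk-closed`
  -- extends to whole walks. The walks of `walk` stay inside `set`, so `set` is connected in itself.
  record Component (C : Subset n) (v : Fin n) : Set where
    field
      set    : Subset n
      root   : v ∈ set
      ⊆C     : set ⊆ C
      walk   : ∀ {w} → w ∈ set → WalkIn G (_∈ set) w v
      closed : ∀ {a b} → a ∈ set → b ∈ C → a ~ b → b ∈ set

    conn : Conn set
    conn = hub⇒connected walk

  -- Starting from `⁅ v ⁆`, the far end of an edge leaving the current set inside `C` is added until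
  -- there is no such edge; `m` bounds the number of vertices of `C` still outside.
  component : v ∈ C → Component C v
  component {v} {C} v∈C =
    grow (suc ∣ C ─ ⁅ v ⁆ ∣) ⁅ v ⁆ ≤-refl (x∈⁅x⁆ v)
      (λ w∈ → subst (_∈ C) (≡-sym (x∈⁅y⁆⇒x≡y v w∈)) v∈C)
      (λ w∈ → subst (λ w → WalkIn G (_∈ ⁅ v ⁆) w v) (≡-sym (x∈⁅y⁆⇒x≡y v w∈)) (here (x∈⁅x⁆ v)))
    where
    grow : ∀ m (R : Subset n) → ∣ C ─ R ∣ < m → v ∈ R → R ⊆ C →
           (∀ {w} → w ∈ R → WalkIn G (_∈ R) w v) → Component C v
    grow (suc m) R size v∈R R⊆C walk
      with any? (λ a → any? (λ b → a ∈? R ×-dec b ∈? C ×-dec ¬? (b ∈? R) ×-dec a ~? b))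
    ... | no ¬exit = record
      { set = R ; root = v∈R ; ⊆C = R⊆C ; walk = walk
      ; closed = λ {a} {b} a∈R b∈C a~b →
          decidable-stable (b ∈? R) (λ b∉R → ¬exit (a , b , a∈R , b∈C , b∉R , a~b)) }
    ... | yes (a , b , a∈R , b∈C , b∉R , a~b) = grow m R′ (⊂-<-suc shrinks size) (R⊆R′ v∈R) R′⊆C walk′
      where
      R′ = R ∪ ⁅ b ⁆
      R⊆R′ : R ⊆ R′
      R⊆R′ = p⊆p∪q ⁅ b ⁆
      b∈R′ : b ∈ R′
      b∈R′ = q⊆p∪q R ⁅ b ⁆ (x∈⁅x⁆ b)
      shrinks : C ─ R′ ⊂ C ─ R
      shrinks = (λ x∈ → x∈p∧x∉q⇒x∈p─q (x∈p─q⇒x∈p x∈) (x∈p─q⇒x∉q x∈ ∘ R⊆R′))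
              , b , x∈p∧x∉q⇒x∈p─q b∈C b∉R , (λ b∈ → x∈p─q⇒x∉q b∈ b∈R′)
      R′⊆C : R′ ⊆ C
      R′⊆C x∈ with x∈p∪q⁻ R ⁅ b ⁆ x∈
      ... | inj₁ x∈R = R⊆C x∈R
      ... | inj₂ x∈b = subst (_∈ C) (≡-sym (x∈⁅y⁆⇒x≡y b x∈b)) b∈C
      walk′ : ∀ {w} → w ∈ R′ → WalkIn G (_∈ R′) w v
      walk′ w∈ with x∈p∪q⁻ R ⁅ b ⁆ w∈
      ... | inj₁ w∈R = walk-map R⊆R′ (walk w∈R)
      ... | inj₂ w∈b rewrite x∈⁅y⁆⇒x≡y b w∈b = step b∈R′ (~-sym a~b) (walk-map R⊆R′ (walk a∈R))

  component≡ : (K : Component C v) → (∀ {w} → w ∈ C → w ∈ Component.set K) → Conn C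
  component≡ K C⊆K = hub⇒connected (λ u∈C → walk-map (Component.⊆C K) (Component.walk K (C⊆K u∈C)))

  outsider : ¬ Conn C → (K : Component C v) → ∃ λ w → w ∈ C × w ∉ Component.set K
  outsider {C} ¬conn K with any? (λ w → w ∈? C ×-dec ¬? (w ∈? Component.set K))
  ... | yes w  = w
  ... | no  ∄w = contradiction
    (component≡ K (λ {w} w∈C → decidable-stable (w ∈? Component.set K) (λ w∉ → ∄w (w , w∈C , w∉)))) ¬conn

  conn? : ∀ C → Dec (Conn C)
  conn? C with nonempty? C
  ... | no  ∄v = yes (λ u _ u∈C _ → contradiction (u , u∈C) ∄v)
  ... | yes (v , v∈C) with component v∈C
  ... | K with any? (λ w → w ∈? C ×-dec ¬? (w ∈? Component.set K))
  ... | no  ∄w = yes (component≡ K (λ {w} w∈C →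
                   decidable-stable (w ∈? Component.set K) (λ w∉ → ∄w (w , w∈C , w∉))))
  ... | yes (w , w∈C , w∉K) = no (λ conn →
                   w∉K (walk-closed (Component.closed K) (Component.root K) (conn v w v∈C w∈C)))

  -- Lobes at cut vertices.

  -- A union of components of C - v.  Neither X nor its complement needs to be assumed connected:
  -- if C is connected, walks can leave X only through v.
  record Lobe (C : Subset n) (v : Fin n) (X : Subset n) : Set where
    field
      v∈C      : v ∈ C
      v∉X      : v ∉ X
      X⊆C      : X ⊆ C
      nonempty : Nonempty X
      attached : ∀ {a b} → a ∈ X → b ∈ C → a ~ b → b ∈ X ⊎ b ≡ v

  -- `K` need not be a monochromatic component: any set closed under monochromatic edges contains
  -- the component of each of its vertices, so its size is a bound. This allows a whole shade class
  -- to serve as `K`, and `K` to be kept unchanged when sets are glued.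
  Clustered : {A : Set} → Subset n → (Fin n → A) → ℕ → Set
  Clustered W f c =
    ∀ {v} → v ∈ W → ∃ λ K → v ∈ K × K ⊆ W × ∣ K ∣ ≤ c ×
      (∀ {a b} → a ∈ K → b ∈ W → a ~ b → f a ≡ f b → b ∈ K)

  -- If u ∈ X is a cut vertex, the vertices that u separates from v form a smaller lobe inside X.
  terminal-lobe : Conn C → (∀ {u} → u ∈ C → u ∉ S → ¬ Conn (C - u)) → v ∉ S → Lobe C v X →
                  ∃₂ λ v′ X′ → Lobe C v′ X′ × v′ ∉ S × X′ ⊆ X × X′ ⊆ S
  terminal-lobe {C} {S} conn cut v∉S L = go _ ≤-refl v∉S L
    where
    go : ∀ m → ∣ X ∣ < m → v ∉ S → Lobe C v X →
         ∃₂ λ v′ X′ → Lobe C v′ X′ × v′ ∉ S × X′ ⊆ X × X′ ⊆ S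
    go {X} {v} (suc m) size v∉S L with any? (λ u → u ∈? X ×-dec ¬? (u ∈? S))
    ... | no ∄u = v , X , L , v∉S , (λ x∈ → x∈) ,
                  λ {x} x∈X → decidable-stable (x ∈? S) (λ x∉S → ∄u (x , x∈X , x∉S))
    ... | yes (u , u∈X , u∉S) =
      let v′ , X′ , L′ , v′∉S , X′⊆A , X′⊆S = go m (⊂-<-suc A⊂X size) u∉S lobe
      in  v′ , X′ , L′ , v′∉S , proj₁ A⊂X ∘ X′⊆A , X′⊆S
      where
      open Lobe L
      u∈C = X⊆C u∈X
      v≢u : v ≢ u
      v≢u refl = v∉X u∈X
      K = component (x∈p∧x≢y⇒x∈p-y v∈C v≢u)
      module K = Component K
      A = (X - u) ─ K.set
      in-A : ∀ {x} → x ∈ X → x ≢ u → x ∉ K.set → x ∈ A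
      in-A x∈X x≢u x∉K = x∈p∧x∉q⇒x∈p─q (x∈p∧x≢y⇒x∈p-y x∈X x≢u) x∉K
      A⊆X : A ⊆ X
      A⊆X = x∈p─q⇒x∈p ∘ x∈p─q⇒x∈p
      u∉A : u ∉ A
      u∉A u∈A = x∈p-y⇒x≢y (x∈p─q⇒x∈p u∈A) refl
      A⊂X : A ⊂ X
      A⊂X = A⊆X , u , u∈X , u∉A
      -- Up to its first visit to `v` the walk cannot enter `X`, so it avoids `u`.
      outside⊆K : ∀ {w} → w ∉ X → WalkIn G (_∈ C) w v → w ∈ K.set
      outside⊆K w∉X (here _) = K.root
      outside⊆K {w} w∉X (step {w = x} w∈C w~x p) with w ≟ v
      ... | yes refl = K.root
      ... | no  w≢v  = K.closed (outside⊆K x∉X p) (x∈p∧x≢y⇒x∈p-y w∈C (λ { refl → w∉X u∈X })) (~-sym w~x)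
        where
        x∉X : x ∉ X
        x∉X x∈X with attached x∈X w∈C (~-sym w~x)
        ... | inj₁ w∈X = w∉X w∈X
        ... | inj₂ w≡v = w≢v w≡v
      lobe : Lobe C u A
      lobe .Lobe.v∈C = u∈C
      lobe .Lobe.v∉X = u∉A
      lobe .Lobe.X⊆C = X⊆C ∘ A⊆X
      -- Some vertex of `C - u` is missed by `K`, and by `outside⊆K` it must lie in `X`.
      lobe .Lobe.nonempty with outsider (cut u∈C u∉S) K
      ... | w , w∈C-u , w∉K = w , in-A
        (decidable-stable (w ∈? X) (λ w∉X → w∉K (outside⊆K w∉X (conn w v (x∈p─q⇒x∈p w∈C-u) v∈C))))
        (x∈p-y⇒x≢y w∈C-u) w∉K
      lobe .Lobe.attached {a} {b} a∈A b∈C a~b with b ≟ u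
      ... | yes b≡u = inj₂ b≡u
      ... | no  b≢u = inj₁ (in-A b∈X b≢u b∉K)
        where
        a∉K = x∈p─q⇒x∉q a∈A
        b∉K : b ∉ K.set
        b∉K b∈K = a∉K (K.closed b∈K
          (x∈p∧x≢y⇒x∈p-y (X⊆C (A⊆X a∈A)) (x∈p-y⇒x≢y (x∈p─q⇒x∈p a∈A))) (~-sym a~b))
        b∈X : b ∈ X
        b∈X with attached (A⊆X a∈A) b∈C a~b
        ... | inj₁ b∈X  = b∈X
        ... | inj₂ refl = contradiction K.root b∉K

  -- One component of `C - v` and the union of all the others are disjoint lobes, so one of the two
  -- contains at most half of `S`.
  light-lobe : Conn C → v ∈ C → v ∉ S → ¬ Conn (C - v) →
               ∃ λ X → Lobe C v X × ∣ X ∩ S ∣ ≤ ⌊ ∣ S ∣ /2⌋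
  light-lobe {C} {v} {S} conn v∈C v∉S ¬conn with nonempty? (C - v)
  ... | no  ∄b = contradiction (λ b _ b∈ _ → contradiction (b , b∈) ∄b) ¬conn
  ... | yes (b , b∈) = pick (≤-total ∣ K.set ∩ S ∣ ∣ Y ∩ S ∣)
    where
    K = component b∈
    module K = Component K
    Y = (C - v) ─ K.set
    lobe-K : Lobe C v K.set
    lobe-K .Lobe.v∈C = v∈C
    lobe-K .Lobe.v∉X v∈K = x∈p-y⇒x≢y (K.⊆C v∈K) refl
    lobe-K .Lobe.X⊆C = x∈p─q⇒x∈p ∘ K.⊆C
    lobe-K .Lobe.nonempty = b , K.root
    lobe-K .Lobe.attached {a} {c} a∈ c∈C a~c with c ≟ v
    ... | yes c≡v = inj₂ c≡v
    ... | no  c≢v = inj₁ (K.closed a∈ (x∈p∧x≢y⇒x∈p-y c∈C c≢v) a~c)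
    lobe-Y : Lobe C v Y
    lobe-Y .Lobe.v∈C = v∈C
    lobe-Y .Lobe.v∉X v∈Y = x∈p-y⇒x≢y (x∈p─q⇒x∈p v∈Y) refl
    lobe-Y .Lobe.X⊆C = x∈p─q⇒x∈p ∘ x∈p─q⇒x∈p
    lobe-Y .Lobe.nonempty with outsider ¬conn K
    ... | w , w∈ , w∉K = w , x∈p∧x∉q⇒x∈p─q w∈ w∉K
    lobe-Y .Lobe.attached {a} {c} a∈ c∈C a~c with c ≟ v
    ... | yes c≡v = inj₂ c≡v
    ... | no  c≢v = inj₁ (x∈p∧x∉q⇒x∈p─q (x∈p∧x≢y⇒x∈p-y c∈C c≢v)
                      (λ c∈K → x∈p─q⇒x∉q a∈ (K.closed c∈K (x∈p─q⇒x∈p a∈) (~-sym a~c))))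
    total : ∣ K.set ∩ S ∣ + ∣ Y ∩ S ∣ ≤ ∣ S ∣
    total = disjoint⇒∣p∣+∣q∣≤∣r∣
      (λ x∈K x∈Y → x∈p─q⇒x∉q (p∩q⊆p Y S x∈Y) (p∩q⊆p K.set S x∈K))
      (p∩q⊆q K.set S) (p∩q⊆q Y S)
    half : ∀ {i s} → i + i ≤ s → i ≤ ⌊ s /2⌋
    half {i} 2i≤s = ≤-trans (≤-reflexive (n≡⌊n+n/2⌋ i)) (⌊n/2⌋-mono 2i≤s)
    pick : ∣ K.set ∩ S ∣ ≤ ∣ Y ∩ S ∣ ⊎ ∣ Y ∩ S ∣ ≤ ∣ K.set ∩ S ∣ →
           ∃ λ X → Lobe C v X × ∣ X ∩ S ∣ ≤ ⌊ ∣ S ∣ /2⌋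
    pick (inj₁ K≤Y) = K.set , lobe-K , half (≤-trans (+-mono-≤ ≤-refl K≤Y) total)
    pick (inj₂ Y≤K) = Y , lobe-Y , half (≤-trans (+-mono-≤ Y≤K ≤-refl) total)

  -- Two-shaded connected sets through given terminals.

  module _ (k : ℕ) where

    -- The vertices of `C` outside `set` receive no shade here; they are left to later pieces.
    record Spanner (C S : Subset n) : Set where
      field
        set       : Subset n
        colour    : Fin n → Fin 2
        S⊆        : S ⊆ set
        ⊆C        : set ⊆ C
        connected : Conn set
        clustered : Clustered set colour ⌈ k /2⌉

    all-terminals : Conn C → C ⊆ S → S ⊆ C → ∣ S ∣ ≤ k → Spanner C S
    all-terminals {C} {S} conn C⊆S S⊆C ∣S∣≤k with halve C
    ... | q , r , q⊆C , r⊆C , cover , ∣q∣≤ , ∣r∣≤ = record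
      { set = C ; colour = colour ; S⊆ = S⊆C ; ⊆C = λ x∈ → x∈ ; connected = conn ; clustered = clustered }
      where
      ∣C∣≤k : ∣ C ∣ ≤ k
      ∣C∣≤k = ≤-trans (p⊆q⇒∣p∣≤∣q∣ C⊆S) ∣S∣≤k
      colour : Fin n → Fin 2
      colour = override q (λ _ → zero) (λ _ → suc zero)
      clustered : Clustered C colour ⌈ k /2⌉
      clustered {v} v∈C with v ∈? q
      -- `⌈ n /2⌉` is `⌊ suc n /2⌋` by definition, hence the `s≤s` under monotonicity.
      ... | yes v∈q = q , v∈q , q⊆C , ≤-trans ∣q∣≤ (⌊n/2⌋-mono (s≤s ∣C∣≤k)) , closed
        where
        closed : ∀ {a b} → a ∈ q → b ∈ C → a ~ b → colour a ≡ colour b → b ∈ q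
        closed {a} {b} a∈q _ _ eq = decidable-stable (b ∈? q) λ b∉q → contradiction
          (trans (≡-sym (override-∈ (λ _ → zero) (λ _ → suc zero) a∈q)) (trans eq (override-∉ _ _ b∉q)))
          (λ ())
      ... | no v∉q = C ─ q , x∈p∧x∉q⇒x∈p─q v∈C v∉q , x∈p─q⇒x∈p ,
        ≤-trans (p⊆q⇒∣p∣≤∣q∣ {p = C ─ q} (λ x∈ → cover (x∈p─q⇒x∈p x∈) (x∈p─q⇒x∉q x∈)))
          (≤-trans ∣r∣≤ (≤-trans (⌊n/2⌋-mono ∣C∣≤k) (⌊n/2⌋≤⌈n/2⌉ k))) , closed
        where
        closed : ∀ {a b} → a ∈ C ─ q → b ∈ C → a ~ b → colour a ≡ colour b → b ∈ C ─ q
        closed {a} {b} a∈ b∈C _ eq = x∈p∧x∉q⇒x∈p─q b∈C λ b∈q → contradiction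
          (trans (≡-sym (override-∉ (λ _ → zero) (λ _ → suc zero) (x∈p─q⇒x∉q a∈))) (trans eq (override-∈ _ _ b∈q)))
          (λ ())

    -- A walk to `v` that starts outside `X` can enter `X` only from `v`, so it may be stopped
    -- there.
    remove-lobe : Conn C → Lobe C v X → Conn (C ─ X)
    remove-lobe {C} {v} {X} conn L = hub⇒connected λ {u} u∈ →
      reroute (x∈p─q⇒x∉q u∈) (conn u v (x∈p─q⇒x∈p u∈) v∈C)
      where
      open Lobe L
      reroute : ∀ {u} → u ∉ X → WalkIn G (_∈ C) u v → WalkIn G (_∈ C ─ X) u v
      reroute u∉X (here u∈C) = here (x∈p∧x∉q⇒x∈p─q u∈C u∉X)
      reroute u∉X (step {w = w} u∈C u~w p) with w ∈? X
      ... | no  w∉X = step (x∈p∧x∉q⇒x∈p─q u∈C u∉X) u~w (reroute w∉X p)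
      ... | yes w∈X with attached w∈X u∈C (~-sym u~w)
      ...   | inj₁ u∈X  = contradiction u∈X u∉X
      ...   | inj₂ refl = here (x∈p∧x∉q⇒x∈p─q u∈C u∉X)

    -- `v` is a terminal of the smaller spanner and hence belongs to it, so the lobe can be hung on.
    -- All edges between `X` and that spanner end at `v`, whose shade is opposite to that of `X`;
    -- thus `X` is a cluster set by itself and the old ones stay closed.
    attach-lobe : Conn C → Lobe C v X → X ⊆ S → ∣ X ∣ ≤ ⌈ k /2⌉ →
                  Spanner (C ─ X) ((S ─ X) ∪ ⁅ v ⁆) → Spanner C S
    attach-lobe {C} {v} {X} {S} conn L X⊆S ∣X∣≤ T = record
      { set = W ; colour = colour ; S⊆ = S⊆W ; ⊆C = W⊆C
      ; connected = hub⇒connected to-v ; clustered = clustered }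
      where
      open Lobe L
      module T = Spanner T
      W = T.set ∪ X
      flipped : Fin n → Fin 2
      flipped _ = opposite (T.colour v)
      colour = override X flipped T.colour
      T⊆W : T.set ⊆ W
      T⊆W = p⊆p∪q X
      X⊆W : X ⊆ W
      X⊆W = q⊆p∪q T.set X
      v∈T : v ∈ T.set
      v∈T = T.S⊆ (q⊆p∪q (S ─ X) ⁅ v ⁆ (x∈⁅x⁆ v))
      T∩X : ∀ {x} → x ∈ T.set → x ∉ X
      T∩X x∈T = x∈p─q⇒x∉q (T.⊆C x∈T)
      S⊆W : S ⊆ W
      S⊆W {x} x∈S with x ∈? X
      ... | yes x∈X = X⊆W x∈X
      ... | no  x∉X = T⊆W (T.S⊆ (p⊆p∪q ⁅ v ⁆ (x∈p∧x∉q⇒x∈p─q x∈S x∉X)))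
      W⊆C : W ⊆ C
      W⊆C x∈ with x∈p∪q⁻ T.set X x∈
      ... | inj₁ x∈T = x∈p─q⇒x∈p (T.⊆C x∈T)
      ... | inj₂ x∈X = X⊆C x∈X
      along-X : ∀ {u} → u ∈ X → WalkIn G (_∈ C) u v → WalkIn G (_∈ W) u v
      along-X u∈X (here _) = here (X⊆W u∈X)
      along-X u∈X (step u∈C u~w p) with attached u∈X (walk-source p) u~w
      ... | inj₁ w∈X  = step (X⊆W u∈X) u~w (along-X w∈X p)
      ... | inj₂ refl = step (X⊆W u∈X) u~w (here (T⊆W v∈T))
      to-v : ∀ {u} → u ∈ W → WalkIn G (_∈ W) u v
      to-v {u} u∈ with x∈p∪q⁻ T.set X u∈
      ... | inj₁ u∈T = walk-map T⊆W (T.connected u v u∈T v∈T)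
      ... | inj₂ u∈X = along-X u∈X (conn u v (X⊆C u∈X) v∈C)
      X≢v : ∀ {x} → x ∈ X → colour x ≢ colour v
      X≢v x∈X eq = opposite≢ (T.colour v)
        (trans (≡-sym (override-∈ flipped T.colour x∈X)) (trans eq (override-∉ flipped T.colour v∉X)))
      clustered : Clustered W colour ⌈ k /2⌉
      clustered {u} u∈ with x∈p∪q⁻ T.set X u∈
      ... | inj₂ u∈X = X , u∈X , X⊆W , ∣X∣≤ , closed
        where
        closed : ∀ {a b} → a ∈ X → b ∈ W → a ~ b → colour a ≡ colour b → b ∈ X
        closed a∈X b∈W a~b eq with attached a∈X (W⊆C b∈W) a~b
        ... | inj₁ b∈X  = b∈X
        ... | inj₂ refl = contradiction eq (X≢v a∈X)
      ... | inj₁ u∈T with T.clustered u∈T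
      ...   | K , u∈K , K⊆T , ∣K∣≤ , K-closed = K , u∈K , T⊆W ∘ K⊆T , ∣K∣≤ , closed
        where
        closed : ∀ {a b} → a ∈ K → b ∈ W → a ~ b → colour a ≡ colour b → b ∈ K
        closed a∈K b∈W a~b eq with x∈p∪q⁻ T.set X b∈W
        ... | inj₁ b∈T = K-closed a∈K b∈T a~b
          (trans (≡-sym (override-∉ flipped T.colour (T∩X (K⊆T a∈K))))
            (trans eq (override-∉ flipped T.colour (T∩X b∈T))))
        ... | inj₂ b∈X with attached b∈X (x∈p─q⇒x∈p (T.⊆C (K⊆T a∈K))) (~-sym a~b)
        ...   | inj₁ a∈X  = contradiction a∈X (T∩X (K⊆T a∈K))
        ...   | inj₂ refl = contradiction (≡-sym eq) (X≢v b∈X)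

    spanner : Conn C → S ⊆ C → ∣ S ∣ ≤ k → Spanner C S
    spanner = go _ ≤-refl
      where
      go : ∀ m → ∣ C ∣ < m → Conn C → S ⊆ C → ∣ S ∣ ≤ k → Spanner C S
      go {C} {S} (suc m) size conn S⊆C ∣S∣≤k
        with any? (λ u → u ∈? C ×-dec ¬? (u ∈? S) ×-dec conn? (C - u))
      ... | yes (u , u∈C , u∉S , conn′) = record { T ; ⊆C = x∈p─q⇒x∈p ∘ T.⊆C }
        where
        S⊆C-u : S ⊆ C - u
        S⊆C-u x∈S = x∈p∧x≢y⇒x∈p-y (S⊆C x∈S) (λ { refl → u∉S x∈S })
        T : Spanner (C - u) S
        T = go m (⊂-<-suc (x∈p⇒p-x⊂p u∈C) size) conn′ S⊆C-u ∣S∣≤k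
        module T = Spanner T
      ... | no ∄u with any? (λ v → v ∈? C ×-dec ¬? (v ∈? S))
      ...   | no ∄v = all-terminals conn
                (λ {x} x∈C → decidable-stable (x ∈? S) (λ x∉S → ∄v (x , x∈C , x∉S))) S⊆C ∣S∣≤k
      ...   | yes (v₀ , v₀∈C , v₀∉S)
        with light-lobe conn v₀∈C v₀∉S (λ conn′ → ∄u (v₀ , v₀∈C , v₀∉S , conn′))
      ...   | X₀ , L₀ , light
        with terminal-lobe conn (λ u∈C u∉S conn′ → ∄u (_ , u∈C , u∉S , conn′)) v₀∉S L₀
      ...   | v , X , L , v∉S , X⊆X₀ , X⊆S =
        attach-lobe conn L X⊆S ∣X∣≤ (go m (⊂-<-suc C─X⊂C size) (remove-lobe conn L) S′⊆ ∣S′∣≤k)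
        where
        open Lobe L
        C─X⊂C : C ─ X ⊂ C
        C─X⊂C with nonempty
        ... | x , x∈X = x∈p─q⇒x∈p , x , X⊆C x∈X , (λ x∈ → x∈p─q⇒x∉q x∈ x∈X)
        -- Since `X` consists of terminals it lies in `X₀ ∩ S`, and the bound for the light lobe
        -- `X₀` applies.
        ∣X∣≤ : ∣ X ∣ ≤ ⌈ k /2⌉
        ∣X∣≤ = ≤-trans (p⊆q⇒∣p∣≤∣q∣ (λ x∈X → x∈p∩q⁺ (X⊆X₀ x∈X , X⊆S x∈X)))
                 (≤-trans light (≤-trans (⌊n/2⌋-mono ∣S∣≤k) (⌊n/2⌋≤⌈n/2⌉ k)))
        S′⊆ : (S ─ X) ∪ ⁅ v ⁆ ⊆ C ─ X
        S′⊆ x∈ with x∈p∪q⁻ (S ─ X) ⁅ v ⁆ x∈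
        ... | inj₁ x∈S─X = x∈p∧x∉q⇒x∈p─q (S⊆C (x∈p─q⇒x∈p x∈S─X)) (x∈p─q⇒x∉q x∈S─X)
        ... | inj₂ x∈v rewrite x∈⁅y⁆⇒x≡y v x∈v = x∈p∧x∉q⇒x∈p─q v∈C v∉X
        -- The one new terminal `v` is paid for by `X`, which is nonempty and consists of terminals
        -- that are dropped.
        ∣S′∣≤k : ∣ (S ─ X) ∪ ⁅ v ⁆ ∣ ≤ k
        ∣S′∣≤k = ≤-trans (∣p∪q∣≤∣p∣+∣q∣ (S ─ X) ⁅ v ⁆)
          (≤-trans (+-mono-≤ (≤-refl {∣ S ─ X ∣})
                     (≤-trans (≤-reflexive (∣⁅x⁆∣≡1 v)) (nonempty⇒0<∣p∣ nonempty)))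
          (≤-trans (disjoint⇒∣p∣+∣q∣≤∣r∣ {p = S ─ X} x∈p─q⇒x∉q x∈p─q⇒x∈p X⊆S) ∣S∣≤k))

  -- Clique minors from pairwise touching sets.

  Touches : Subset n → Subset n → Set
  Touches C D = ∃₂ λ a b → a ∈ C × b ∈ D × a ~ b

  touches? : ∀ C D → Dec (Touches C D)
  touches? C D = any? (λ a → any? (λ b → a ∈? C ×-dec b ∈? D ×-dec a ~? b))

  Branch : Subset n → Set
  Branch B = Nonempty B × Conn B

  Joined : Subset n → Subset n → Set
  Joined B D = Disjoint B D × Touches B D

  branch : (Bs : List (Subset n)) → Fin n → Maybe (Fin (length Bs))
  branch []       v = nothing
  branch (B ∷ Bs) v = if does (v ∈? B) then just zero else Maybe.map suc (branch Bs v)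

  branch⇒∈ : ∀ Bs {i} → branch Bs v ≡ just i → v ∈ lookup Bs i
  branch⇒∈ {v} (B ∷ Bs) {i} eq with v ∈? B | branch Bs v in eq′
  branch⇒∈ (B ∷ Bs) refl | yes v∈B | _      = v∈B
  branch⇒∈ (B ∷ Bs) refl | no  _   | just i = branch⇒∈ Bs eq′

  -- `branch` picks the first listed set containing `v`; disjointness makes it the only one.
  ∈⇒branch : ∀ {Bs} → AllPairs Joined Bs → ∀ {i} → v ∈ lookup Bs i → branch Bs v ≡ just i
  ∈⇒branch {v} {B ∷ Bs} (_ ∷ _) {zero} v∈B rewrite dec-true (v ∈? B) v∈B = refl
  ∈⇒branch {v} {B ∷ Bs} (B! ∷ Bs!) {suc i} v∈Bᵢ
    rewrite dec-false (v ∈? B) (λ v∈B → proj₁ (All.lookup B! (∈-lookup i)) v∈B v∈Bᵢ)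
          | ∈⇒branch Bs! {i} v∈Bᵢ = refl

  joined : ∀ {Bs} → AllPairs Joined Bs → ∀ i j → i ≢ j → Touches (lookup Bs i) (lookup Bs j)
  joined (_ ∷ _)    zero    zero    i≢j = contradiction refl i≢j
  joined (B! ∷ _)   zero    (suc j) _   = proj₂ (All.lookup B! (∈-lookup j))
  joined (B! ∷ _)   (suc i) zero    _   with proj₂ (All.lookup B! (∈-lookup i))
  ... | a , b , a∈B , b∈Bᵢ , a~b = b , a , b∈Bᵢ , a∈B , ~-sym a~b
  joined (_ ∷ Bs!)  (suc i) (suc j) i≢j = joined Bs! i j (i≢j ∘ cong suc)

  clique-minor : ∀ Bs → All Branch Bs → AllPairs Joined Bs → HasKMinor (length Bs) G
  clique-minor Bs branches Bs! = record
    { β         = branch Bs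
    ; nonempty  = λ i → let v , v∈ = proj₁ (at i) in v , ∈⇒branch Bs! v∈
    ; connected = λ i u v u∈ v∈ →
        walk-map (∈⇒branch Bs!) (proj₂ (at i) u v (branch⇒∈ Bs u∈) (branch⇒∈ Bs v∈))
    ; adjacent  = λ i j i≢j → let a , b , a∈ , b∈ , a~b = joined Bs! i j i≢j
                              in  a , b , ∈⇒branch Bs! a∈ , ∈⇒branch Bs! b∈ , a~b
    }
    where
    at : ∀ i → Branch (lookup Bs i)
    at i = All.lookup branches (∈-lookup i)

  -- A longer list is cut down to its first `t` members, because a model has exactly `t` branch
  -- sets.
  clique-bound : ∀ {t} → ¬ HasKMinor t G → ∀ Bs → All Branch Bs → AllPairs Joined Bs → length Bs < t
  clique-bound {t} ¬minor Bs branches Bs! = ≰⇒> λ t≤∣Bs∣ →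
    ¬minor (subst (λ s → HasKMinor s G)
      (trans (length-take t Bs) (m≤n⇒m⊓n≡m t≤∣Bs∣))
      (clique-minor (take t Bs) (All.take⁺ t branches) (AllPairs.take⁺ t Bs!)))

  -- Choice of terminals.

  terminals : ∀ Qs → All (Touches C) Qs → ∃ λ S → S ⊆ C × ∣ S ∣ ≤ length Qs × All (Touches S) Qs
  terminals []       []                              =
    ⊥ , (λ x∈ → contradiction x∈ ∉⊥) , ≤-reflexive (∣⊥∣≡0 n) , []
  terminals {C} (Q ∷ Qs) ((a , b , a∈C , b∈Q , a~b) ∷ ts) with terminals Qs ts
  ... | S , S⊆C , ∣S∣≤ , ts′ =
    ⁅ a ⁆ ∪ S , ⊆C ,
    ≤-trans (∣p∪q∣≤∣p∣+∣q∣ ⁅ a ⁆ S) (+-mono-≤ (≤-reflexive (∣⁅x⁆∣≡1 a)) ∣S∣≤) ,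
    (a , b , p⊆p∪q S (x∈⁅x⁆ a) , b∈Q , a~b) ∷
    All.map (λ (c , d , c∈S , rest) → c , d , q⊆p∪q ⁅ a ⁆ S c∈S , rest) ts′
    where
    ⊆C : ⁅ a ⁆ ∪ S ⊆ C
    ⊆C x∈ with x∈p∪q⁻ ⁅ a ⁆ S x∈
    ... | inj₁ x∈a = subst (_∈ C) (≡-sym (x∈⁅y⁆⇒x≡y a x∈a)) a∈C
    ... | inj₂ x∈S = S⊆C x∈S

  -- A component with no adjacent pieces yields no terminals, and the next piece could then be empty
  -- and leave the uncoloured set unchanged. An arbitrary vertex of `C` is made a terminal in that
  -- case.
  nonempty-terminals : ∀ {k} → 1 ≤ k → v ∈ C → S ⊆ C → ∣ S ∣ ≤ k →
                       ∃ λ S′ → S ⊆ S′ × S′ ⊆ C × Nonempty S′ × ∣ S′ ∣ ≤ k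
  nonempty-terminals {v} {C} {S} 1≤k v∈C S⊆C ∣S∣≤k with nonempty? S
  ... | yes S≢∅ = S , (λ x∈ → x∈) , S⊆C , S≢∅ , ∣S∣≤k
  ... | no  S≡∅ = ⁅ v ⁆ , (λ x∈S → contradiction (_ , x∈S) S≡∅) ,
                  (λ x∈v → subst (_∈ C) (≡-sym (x∈⁅y⁆⇒x≡y v x∈v)) v∈C) ,
                  (v , x∈⁅x⁆ v) , ≤-trans (≤-reflexive (∣⁅x⁆∣≡1 v)) 1≤k

  -- Cutting off pieces and colouring them; here `t` is `suc (suc k)`.

  module _ {k : ℕ} (1≤k : 1 ≤ k) (¬minor : ¬ HasKMinor (suc (suc k)) G) where

    Piece : Set
    Piece = Subset n × Fin (suc k)

    -- Pieces adjacent to one component of the uncoloured set D are adjacent to each other; walks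
    -- instead of components make this condition inherited by subsets of D.
    Linked : Subset n → Piece → Piece → Set
    Linked D (B , _) (B′ , _) = Disjoint B B′ ×
      (∀ {u w b b′} → WalkIn G (_∈ D) u w → b ∈ B → u ~ b → b′ ∈ B′ → w ~ b′ → Touches B B′)

    Settled : Subset n → Piece → Set
    Settled D (B , _) = Conn B × Disjoint D B

    -- Only `D` is coloured; the pieces in `Qs` act as constraints. `avoids` compares main colours,
    -- so no choice of shades can merge a cluster of `D` with one of an earlier piece.
    record Colouring (D : Subset n) (Qs : List Piece) : Set where
      field
        colour    : Fin n → Fin 2 × Fin (suc k)
        avoids    : All (λ (B , c) → ∀ {u w} → u ∈ D → w ∈ B → u ~ w → proj₂ (colour u) ≢ c) Qs
        clustered : Clustered D colour ⌈ k /2⌉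

    record Step (D : Subset n) (Qs : List Piece) : Set where
      field
        new      : Fin (suc k)
        W        : Subset n
        shade    : Fin n → Fin 2
        nonempty : Nonempty W
        W⊆D      : W ⊆ D
        conn     : Conn W
        shaded   : Clustered W shade ⌈ k /2⌉
        fresh    : All (λ (B , c) → Touches W B → new ≢ c) Qs
        linked   : All (Linked (D ─ W) (W , new)) Qs

    module _ {D : Subset n} {v : Fin n} (K : Component D v)
             (Qs : List Piece) (settled : All (Settled D) Qs) (Qs! : AllPairs (Linked D) Qs) where

      private
        module K = Component K

        touching? : (Q : Piece) → Dec (Touches K.set (proj₁ Q))
        touching? Q = touches? K.set (proj₁ Q)

      adjacent : List Piece
      adjacent = filter touching? Qs

      adjacent-touches : All (Touches K.set ∘ proj₁) adjacent
      adjacent-touches = All.all-filter touching? Qs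

      -- Two adjacent pieces are joined because a walk in `K.set` between their neighbours triggers
      -- `Linked`. With `K.set` as one more branch set they form a clique minor, so one more than
      -- their number is less than `suc (suc k)`.
      ∣adjacent∣≤k : length adjacent ≤ k
      ∣adjacent∣≤k = subst (_≤ k) (length-map proj₁ adjacent)
        (s≤s⁻¹ (s≤s⁻¹ (clique-bound ¬minor (K.set ∷ map proj₁ adjacent) branches joins)))
        where
        adjacent-settled : All (Settled D) adjacent
        adjacent-settled = All.filter⁺ touching? settled
        as-branch : ∀ {Q} → Touches K.set (proj₁ Q) × Settled D Q → Branch (proj₁ Q)
        as-branch ((_ , b , _ , b∈B , _) , (conn , _)) = (b , b∈B) , conn
        branches : All Branch (K.set ∷ map proj₁ adjacent)
        branches = ((v , K.root) , K.conn) ∷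
                   All.map⁺ (All.zipWith (λ {Q} → as-branch {Q}) (adjacent-touches , adjacent-settled))
        join-K : ∀ {Q} → Touches K.set (proj₁ Q) × Settled D Q → Joined K.set (proj₁ Q)
        join-K (touch , (_ , disj)) = disj ∘ K.⊆C , touch
        join : ∀ {P Q} → Touches K.set (proj₁ P) → Touches K.set (proj₁ Q) → Linked D P Q →
               Joined (proj₁ P) (proj₁ Q)
        join (a , b , a∈K , b∈B , a~b) (a′ , b′ , a′∈K , b′∈B′ , a′~b′) (disj , link) =
          disj , link (walk-map K.⊆C (K.conn a a′ a∈K a′∈K)) b∈B a~b b′∈B′ a′~b′
        joins : AllPairs Joined (K.set ∷ map proj₁ adjacent)
        joins = All.map⁺ (All.zipWith (λ {Q} → join-K {Q}) (adjacent-touches , adjacent-settled)) ∷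
                AllPairs.map⁺ (allPairs-zip (λ {P} {Q} → join {P} {Q}) adjacent-touches (AllPairs.filter⁺ touching? Qs!))

      free : ∃ (_∉ˡ map proj₂ adjacent)
      free = missing (map proj₂ adjacent)
               (s≤s (subst (_≤ k) (≡-sym (length-map proj₂ adjacent)) ∣adjacent∣≤k))

      step-with : Nonempty S → All (Touches S) (map proj₁ adjacent) → Spanner k K.set S → Step D Qs
      step-with {S} (x , x∈S) S-touches T = record
        { new = proj₁ free ; W = T.set ; shade = T.colour ; nonempty = x , T.S⊆ x∈S
        ; W⊆D = K.⊆C ∘ T.⊆C ; conn = T.connected ; shaded = T.clustered
        ; fresh = All.tabulate fresh ; linked = All.tabulate linked }
        where
        module T = Spanner T
        fresh : ∀ {Q} → Q ∈ˡ Qs → Touches T.set (proj₁ Q) → proj₁ free ≢ proj₂ Q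
        fresh Q∈Qs (a , b , a∈W , b∈B , a~b) new≡c =
          proj₂ free (subst (_∈ˡ map proj₂ adjacent) (≡-sym new≡c)
            (∈-map⁺ proj₂ (∈-filter⁺ touching? Q∈Qs (a , b , T.⊆C a∈W , b∈B , a~b))))
        W-touches : ∀ {Q} → Q ∈ˡ Qs → Touches K.set (proj₁ Q) → Touches T.set (proj₁ Q)
        W-touches Q∈Qs touch with All.lookup (All.map⁻ S-touches) (∈-filter⁺ touching? Q∈Qs touch)
        ... | a , b , a∈S , rest = a , b , T.S⊆ a∈S , rest
        linked : ∀ {Q} → Q ∈ˡ Qs → Linked (D ─ T.set) (T.set , proj₁ free) Q
        linked {B , _} Q∈Qs = (λ x∈W → proj₂ (All.lookup settled Q∈Qs) (K.⊆C (T.⊆C x∈W))) , link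
          where
          link : ∀ {u w b b′} → WalkIn G (_∈ D ─ T.set) u w →
                 b ∈ T.set → u ~ b → b′ ∈ B → w ~ b′ → Touches T.set B
          link {w = w} {b′ = b′} walk b∈W u~b b′∈B w~b′ = W-touches Q∈Qs (w , b′ , w∈K , b′∈B , w~b′)
            where
            w∈K : w ∈ K.set
            -- The walk starts next to `T.set`, which lies in `K.set`, and stays in `D`, so it never
            -- leaves the component. Hence `B` is one of the adjacent pieces, and a terminal in
            -- `T.set` touches it.
            w∈K = walk-closed (λ a∈K b∈D─W → K.closed a∈K (x∈p─q⇒x∈p b∈D─W))
              (K.closed (T.⊆C b∈W) (x∈p─q⇒x∈p (walk-source walk)) (~-sym u~b)) walk

      next-step : Step D Qs
      next-step with terminals (map proj₁ adjacent) (All.map⁺ adjacent-touches)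
      ... | S₀ , S₀⊆K , ∣S₀∣≤ , S₀-touches
        with nonempty-terminals 1≤k K.root S₀⊆K
               (≤-trans ∣S₀∣≤ (subst (_≤ k) (≡-sym (length-map proj₁ adjacent)) ∣adjacent∣≤k))
      ... | S₁ , S₀⊆S₁ , S₁⊆K , S₁≢∅ , ∣S₁∣≤k =
        step-with S₁≢∅ (All.map (λ (a , b , a∈S₀ , rest) → a , b , S₀⊆S₁ a∈S₀ , rest) S₀-touches)
          (spanner k K.conn S₁⊆K ∣S₁∣≤k)

    -- The colouring of `D ─ W` has `(W , new)` among its constraints, so no monochromatic edge
    -- joins `W` to `D ─ W`, and the cluster sets on both sides stay closed.
    extend : ∀ {Qs} (s : Step D Qs) → let open Step s in
             Colouring (D ─ W) ((W , new) ∷ Qs) → Colouring D Qs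
    extend {D} {Qs} s c = record { colour = colour ; avoids = avoids ; clustered = clustered }
      where
      open Step s
      module c = Colouring c
      new-colour : Fin n → Fin 2 × Fin (suc k)
      new-colour v = shade v , new
      colour = override W new-colour c.colour
      on-W : ∀ {x} → x ∈ W → colour x ≡ new-colour x
      on-W = override-∈ new-colour c.colour
      off-W : ∀ {x} → x ∉ W → colour x ≡ c.colour x
      off-W = override-∉ new-colour c.colour
      avoids : All (λ (B , c) → ∀ {u w} → u ∈ D → w ∈ B → u ~ w → proj₂ (colour u) ≢ c) Qs
      avoids = All.zipWith combined (fresh , All.tail c.avoids)
        where
        combined : ∀ {Q : Piece} → (Touches W (proj₁ Q) → new ≢ proj₂ Q) ×
                   (∀ {u w} → u ∈ D ─ W → w ∈ proj₁ Q → u ~ w → proj₂ (c.colour u) ≢ proj₂ Q) →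
                   ∀ {u w} → u ∈ D → w ∈ proj₁ Q → u ~ w → proj₂ (colour u) ≢ proj₂ Q
        combined (new≢ , old≢) {u} {w} u∈D w∈B u~w eq with toSum (u ∈? W)
        ... | inj₁ u∈W = new≢ (u , w , u∈W , w∈B , u~w) (trans (≡-sym (cong proj₂ (on-W u∈W))) eq)
        ... | inj₂ u∉W = old≢ (x∈p∧x∉q⇒x∈p─q u∈D u∉W) w∈B u~w
                          (trans (≡-sym (cong proj₂ (off-W u∉W))) eq)
      separate : ∀ {a b} → a ∈ D ─ W → b ∈ W → a ~ b → colour a ≢ colour b
      separate a∈ b∈W a~b eq = All.head c.avoids a∈ b∈W a~b
        (cong proj₂ (trans (≡-sym (off-W (x∈p─q⇒x∉q a∈))) (trans eq (on-W b∈W))))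
      clustered : Clustered D colour ⌈ k /2⌉
      clustered {v} v∈D with toSum (v ∈? W)
      ... | inj₁ v∈W with shaded v∈W
      ...   | K , v∈K , K⊆W , ∣K∣≤ , K-closed = K , v∈K , W⊆D ∘ K⊆W , ∣K∣≤ , closed
        where
        closed : ∀ {a b} → a ∈ K → b ∈ D → a ~ b → colour a ≡ colour b → b ∈ K
        closed {a} {b} a∈K b∈D a~b eq with toSum (b ∈? W)
        ... | inj₁ b∈W = K-closed a∈K b∈W a~b
          (cong proj₁ (trans (≡-sym (on-W (K⊆W a∈K))) (trans eq (on-W b∈W))))
        ... | inj₂ b∉W = contradiction (≡-sym eq)
          (separate (x∈p∧x∉q⇒x∈p─q b∈D b∉W) (K⊆W a∈K) (~-sym a~b))
      clustered {v} v∈D | inj₂ v∉W with c.clustered (x∈p∧x∉q⇒x∈p─q v∈D v∉W)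
      ...   | K , v∈K , K⊆D─W , ∣K∣≤ , K-closed = K , v∈K , x∈p─q⇒x∈p ∘ K⊆D─W , ∣K∣≤ , closed
        where
        closed : ∀ {a b} → a ∈ K → b ∈ D → a ~ b → colour a ≡ colour b → b ∈ K
        closed {a} {b} a∈K b∈D a~b eq with toSum (b ∈? W)
        ... | inj₁ b∈W = contradiction eq (separate (K⊆D─W a∈K) b∈W a~b)
        ... | inj₂ b∉W = K-closed a∈K (x∈p∧x∉q⇒x∈p─q b∈D b∉W) a~b
          (trans (≡-sym (off-W (x∈p─q⇒x∉q (K⊆D─W a∈K)))) (trans eq (off-W b∉W)))

    Reduction : Subset n → List Piece → Set
    Reduction D Qs = ∃₂ λ D′ Qs′ → D′ ⊂ D × All (Settled D′) Qs′ × AllPairs (Linked D′) Qs′ ×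
                                   (Colouring D′ Qs′ → Colouring D Qs)

    reduce : ∀ {Qs} → All (Settled D) Qs → AllPairs (Linked D) Qs → Step D Qs → Reduction D Qs
    reduce {D} {Qs} settled Qs! s = D ─ W , (W , new) ∷ Qs , D─W⊂D , settled′ , Qs!′ , extend s
      where
      open Step s
      D─W⊂D : D ─ W ⊂ D
      D─W⊂D with nonempty
      ... | x , x∈W = x∈p─q⇒x∈p , x , W⊆D x∈W , (λ x∈ → x∈p─q⇒x∉q x∈ x∈W)
      shrink-settled : ∀ {Q} → Settled D Q → Settled (D ─ W) Q
      shrink-settled (conn , disj) = conn , disj ∘ x∈p─q⇒x∈p
      shrink-linked : ∀ {P Q} → Linked D P Q → Linked (D ─ W) P Q
      shrink-linked (disj , link) = disj , link ∘ walk-map x∈p─q⇒x∈p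
      settled′ : All (Settled (D ─ W)) ((W , new) ∷ Qs)
      settled′ = (conn , x∈p─q⇒x∉q) ∷ All.map (λ {Q} → shrink-settled {Q}) settled
      Qs!′ : AllPairs (Linked (D ─ W)) ((W , new) ∷ Qs)
      Qs!′ = linked ∷ AllPairs.map (λ {P} {Q} → shrink-linked {P} {Q}) Qs!

    -- Each reduction removes a nonempty piece, so the induction is on the size of `D`; for empty
    -- `D` the constant colour is only a placeholder.
    colour-rest : ∀ m → ∣ D ∣ < m → ∀ Qs → All (Settled D) Qs → AllPairs (Linked D) Qs → Colouring D Qs
    colour-rest {D} (suc m) size Qs settled Qs! with nonempty? D
    ... | no  D≡∅ = record
      { colour    = λ _ → zero , zero
      ; avoids    = All.tabulate (λ _ u∈D → contradiction (_ , u∈D) D≡∅)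
      ; clustered = λ v∈D → contradiction (_ , v∈D) D≡∅ }
    ... | yes (v , v∈D) = continue (reduce settled Qs! (next-step (component v∈D) Qs settled Qs!))
      where
      continue : Reduction D Qs → Colouring D Qs
      continue (D′ , Qs′ , D′⊂D , settled′ , Qs!′ , back) =
        back (colour-rest m (⊂-<-suc D′⊂D size) Qs′ settled′ Qs!′)

    -- The colouring of the whole graph.

    colourable : ColourableWithClustering G (2 * suc k) ⌈ k /2⌉
    colourable = col , clusters
      where
      -- Initially everything is uncoloured and there are no pieces, so the invariants hold
      -- vacuously.
      open Colouring (colour-rest {D = ⊤} _ ≤-refl [] [] [])
      col : Fin n → Fin (2 * suc k)
      col v = combine (proj₁ (colour v)) (proj₂ (colour v))
      col-injective : ∀ {a b} → col a ≡ col b → colour a ≡ colour b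
      col-injective eq with combine-injective _ _ _ _ eq
      ... | eq₁ , eq₂ = cong₂ _,_ eq₁ eq₂
      clusters : HasClustering G col ⌈ k /2⌉
      clusters v xs xs! walks with clustered {v} ∈⊤
      ... | K , v∈K , _ , ∣K∣≤ , K-closed =
        -- A monochromatic walk from `v` cannot leave `K`. The walk predicate compares colours with
        -- `v` only, so equality with the colour of `v` is carried along.
        ≤-trans (unique⊆⇒length≤∣p∣ xs! (All.map (proj₁ ∘ walk-closed closed (v∈K , refl)) walks)) ∣K∣≤
        where
        closed : ∀ {a b} → a ∈ K × col a ≡ col v → col b ≡ col v → a ~ b → b ∈ K × col b ≡ col v
        closed (a∈K , a≡v) b≡v a~b = K-closed a∈K ∈⊤ a~b (col-injective (trans a≡v (≡-sym b≡v))) , b≡v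

theorem1 : ∀ (t : ℕ) → 4 ≤ t → ∀ {n : ℕ} (G : Graph n) →
    ¬ HasKMinor t G → ColourableWithClustering G (2 * t ∸ 2) ⌈ t ∸ 2 /2⌉
theorem1 (suc (suc k)) (s≤s (s≤s 2≤k)) G ¬minor =
  -- For `t` equal to `suc (suc k)`, `2 * t ∸ 2` computes to `k + suc (suc (k + 0))` and `2 * suc k`
  -- to `suc (k + suc (k + 0))`.
  subst (λ c → ColourableWithClustering G c ⌈ k /2⌉) (≡-sym (+-suc k (suc (k + 0))))
    (colourable G (≤-trans (s≤s z≤n) 2≤k) ¬minor)
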